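{- Let $\mathbb{K}_{2,\omega}$ be the graph with vertex set $K_{2,\omega}=A_{+1}\sqcup A_{ -1}$, where $A_{+1},A_{ -1}$ are disjoint countably infinite sets, and edge relation $E=A_{ -1}\times A_{+1}\cup A_{+1}\times A_{ -1}$. Let $\mathbb{G}$ be the structure with domain $G=\mathbb{N}\times K_{2,\omega}$ and two binary relations $E_1=\{((i,x),(j,y))\in G^2: i\neq j\}$ and $E_2=\{((i,x),(j,y))\in G^2: i=j,\ (x,y)\in E\}$. Then on the endomorphism monoid $\mathrm{End}(\mathbb{G})$, the topology of pointwise convergence is strictly finer than the Zariski topology.
   Context: $\mathrm{End}(\mathbb{G})$ is the monoid of maps $G\to G$ preserving $E_1$ and $E_2$, under composition. The topology of pointwise convergence is the subspace topology inherited from the product topology on $G^G$ with each factor discrete. For a monoid $S$, the Zariski topology is generated by all sets $M_{\varphi,\psi}=\{s\in S:\varphi(s)\neq\psi(s)\}$, where $\ell\le k$ are natural numbers, $p_0,\dots,p_k,q_0,\dots,q_\ell\in S$, $\varphi(s)=p_k s p_{k-1}s\cdots s p_0$, $\psi(s)=q_\ell s q_{\ell-1}s\cdots s q_0$ (if $\ell=0$, $\psi(s)=q_0$). -}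

module Defs where

open import Data.Nat using (ℕ; zero; suc; _≤_)
open import Data.Sum using (_⊎_; inj₁; inj₂)
open import Data.Product using (_×_; _,_; Σ; ∃; ∃-syntax; proj₁; proj₂)
open import Data.List using (List)
open import Data.List.Membership.Propositional using (_∈_)
open import Data.List.Relation.Unary.All using (All)
open import Data.Vec using (Vec; []; _∷_)
open import Data.Empty using (⊥)
open import Data.Unit using (⊤)
open import Relation.Nullary using (¬_)
open import Relation.Binary.PropositionalEquality using (_≡_; _≢_)
open import Function using (_∘_; id)

-- The graph K_{2,ω}: vertex set A_{+1} ⊔ A_{-1}, with A_{+1} = inj₁ ℕ
-- and A_{-1} = inj₂ ℕ (two disjoint countably infinite sets).

K2ω : Set
K2ω = ℕ ⊎ ℕ

E : K2ω → K2ω → Set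
E (inj₁ _) (inj₁ _) = ⊥
E (inj₁ _) (inj₂ _) = ⊤
E (inj₂ _) (inj₁ _) = ⊤
E (inj₂ _) (inj₂ _) = ⊥

G : Set
G = ℕ × K2ω

E₁ : G → G → Set
E₁ (i , x) (j , y) = i ≢ j

E₂ : G → G → Set
E₂ (i , x) (j , y) = (i ≡ j) × E x y

-- End(𝔾): maps G → G preserving E₁ and E₂; the monoid operation is
-- composition (elements are compared via their underlying maps).

record End : Set where
  constructor mkEnd
  field
    fun   : G → G
    pres₁ : ∀ a b → E₁ a b → E₁ (fun a) (fun b)
    pres₂ : ∀ a b → E₂ a b → E₂ (fun a) (fun b)
open End public

_·_ : End → End → End
f · g = mkEnd (fun f ∘ fun g)
              (λ a b e → pres₁ f _ _ (pres₁ g a b e))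
              (λ a b e → pres₂ f _ _ (pres₂ g a b e))

_≠_ : End → End → Set
f ≠ g = ∃[ x ] (fun f x ≢ fun g x)

-- Polynomials φ(s) = p_k s p_{k-1} s ⋯ s p_0, given by the coefficient
-- vector (p_k ∷ p_{k-1} ∷ ⋯ ∷ p_0) of length k+1.

evalPoly : ∀ {k} → Vec End (suc k) → End → End
evalPoly (p ∷ [])       s = p
evalPoly (p ∷ q ∷ ps)   s = p · (s · evalPoly (q ∷ ps) s)

record ZData : Set where
  constructor zdata
  field
    k ℓ  : ℕ
    ℓ≤k  : ℓ ≤ k
    ps   : Vec End (suc k)
    qs   : Vec End (suc ℓ)
open ZData public

M : ZData → End → Set
M d s = evalPoly (ps d) s ≠ evalPoly (qs d) s

Subset : Set₁
Subset = End → Set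

ZariskiOpen : Subset → Set
ZariskiOpen U =
  ∀ s → U s →
    Σ (List ZData) λ ds →
      All (λ d → M d s) ds × (∀ t → All (λ d → M d t) ds → U t)

PointwiseOpen : Subset → Set
PointwiseOpen U =
  ∀ s → U s →
    Σ (List G) λ F → (∀ t → (∀ x → x ∈ F → fun t x ≡ fun s x) → U t)

{-# OPTIONS --safe #-}

-- An endomorphism f acts injectively on the components {i} × K_{2,ω} by a map
-- comp f, and on each component it either preserves or exchanges the two sides.
-- Zariski neighbourhoods of the retraction e : (i , ±n) ↦ (i , ±0) cannot force
-- t (0 , +0) = (0 , +0): given finitely many inequations φ(s) ≠ ψ(s) true at
-- s = e, they also hold at t : (i , ±n) ↦ (τ i , ∓0) for a suitable injective τ.
-- If φ and ψ have the same length, the sign changes caused by t instead of e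
-- match on both sides as long as τ fixes enough components.  If the lengths
-- differ, τ is chosen to grow so fast outside these components that the length
-- of a word can be recovered from its value.

module Submission where

open import Defs
open import Data.Fin using (Fin; toℕ; fromℕ<; combine)
import Data.Fin.Properties as Fin
open import Data.List as List using (List; []; _∷_; _++_; [_]; length; concatMap)
open import Data.List.Extrema.Nat using (max; xs≤max; ⊥≤max)
open import Data.List.Membership.Propositional using (_∈_)
open import Data.List.Membership.Propositional.Properties
  using (∈-++⁺ˡ; ∈-++⁺ʳ; ∈-map⁺)
open import Data.List.Relation.Unary.All as All using (All; []; _∷_)
import Data.List.Relation.Unary.All.Properties as All
open import Data.List.Relation.Unary.Any as Any using (here)
import Data.List.Relation.Unary.Any.Properties as Any
open import Data.Nat
  using (ℕ; zero; suc; _+_; _*_; _≤_; _<_; _≤′_; ≤′-refl; ≤′-step; z≤n; s≤s; z<s; _≟_; _≤?_; _<?_)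
open import Data.Nat.Properties
open import Data.Product using (_×_; _,_; Σ; ∃-syntax; proj₁; proj₂)
open import Data.Sum using (inj₁; inj₂; swap)
open import Data.Unit using (tt)
open import Data.Vec using (Vec; []; _∷_; toList)
open import Function using (id)
open import Relation.Binary.PropositionalEquality
  using (_≡_; _≢_; refl; sym; trans; cong; subst)
open import Relation.Nullary using (¬_; Dec; yes; no; contradiction)

-- Polynomials are continuous: Zariski-open sets are pointwise open

Agree : List G → End → End → Set
Agree F t s = ∀ x → x ∈ F → fun t x ≡ fun s x

agree-++ˡ : ∀ F {F′} t {s} → Agree (F ++ F′) t s → Agree F t s
agree-++ˡ F t ag x x∈F = ag x (∈-++⁺ˡ x∈F)

agree-++ʳ : ∀ F {F′} t {s} → Agree (F ++ F′) t s → Agree F′ t s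
agree-++ʳ F t ag x x∈F′ = ag x (∈-++⁺ʳ F x∈F′)

-- `F` collects the points to which `s` is applied while the word is evaluated at `x`; agreement
-- there preserves every intermediate value.
evalPoly-continuous : ∀ {k} (ps : Vec End (suc k)) s x →
  ∃[ F ] (∀ t → Agree F t s → fun (evalPoly ps t) x ≡ fun (evalPoly ps s) x)
evalPoly-continuous (p ∷ []) s x = [] , λ _ _ → refl
evalPoly-continuous (p ∷ q ∷ ps) s x with evalPoly-continuous (q ∷ ps) s x
... | F , cont = fun (evalPoly (q ∷ ps) s) x ∷ F , λ t ag →
  cong (fun p) (trans (cong (fun t) (cont t (agree-++ʳ [ _ ] t {s} ag))) (ag _ (here refl)))

M-open : ∀ d → PointwiseOpen (M d)
M-open d s (x , φ≢ψ)
  with evalPoly-continuous (ps d) s x | evalPoly-continuous (qs d) s x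
... | F , contφ | F′ , contψ = F ++ F′ , λ t ag → x , λ φ≡ψ →
  φ≢ψ (trans (sym (contφ t (agree-++ˡ F t {s} ag))) (trans φ≡ψ (contψ t (agree-++ʳ F t {s} ag))))

All-open : {A : Set} {V : A → Subset} → (∀ d → PointwiseOpen (V d)) →
           ∀ ds → PointwiseOpen (λ t → All (λ d → V d t) ds)
All-open V-open [] s [] = [] , λ _ _ → []
All-open V-open (d ∷ ds) s (v ∷ vs) with V-open d s v | All-open V-open ds s vs
... | F , inV | F′ , inVs =
  F ++ F′ , λ t ag → inV t (agree-++ˡ F t {s} ag) ∷ inVs t (agree-++ʳ F t {s} ag)

→-open : {P : Set} {V : Subset} → Dec P → PointwiseOpen V → PointwiseOpen (λ t → P → V t)
→-open (no ¬p) V-open s v = [] , λ _ _ p → contradiction p ¬p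
→-open (yes p) V-open s v with V-open s (v p)
... | F , inV = F , λ t ag _ → inV t ag

zariski⇒pointwise : ∀ U → ZariskiOpen U → PointwiseOpen U
zariski⇒pointwise U U-open s s∈U with U-open s s∈U
... | ds , s∈M , M⊆U with All-open M-open ds s s∈M
...   | F , inM = F , λ t ag → M⊆U t (inM t ag)

-- Action of endomorphisms on components

comp : End → ℕ → ℕ
comp f i = proj₁ (fun f (i , inj₁ 0))

-- Opposite sides of a component are adjacent, and points on the same side share a neighbour, so
-- preserving `E₂` keeps a component together.
comp-fun : ∀ f z → proj₁ (fun f z) ≡ comp f (proj₁ z)
comp-fun f (i , inj₂ n) = proj₁ (pres₂ f (i , inj₂ n) (i , inj₁ 0) (refl , tt))
comp-fun f (i , inj₁ n) =
  trans (proj₁ (pres₂ f (i , inj₁ n) (i , inj₂ 0) (refl , tt))) (comp-fun f (i , inj₂ 0))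

comp-injective : ∀ f {i j} → comp f i ≡ comp f j → i ≡ j
comp-injective f {i} {j} eq with i ≟ j
... | yes i≡j = i≡j
... | no  i≢j = contradiction eq (pres₁ f (i , inj₁ 0) (j , inj₁ 0) i≢j)

-- The retraction and its side-exchanging variant

shrink : K2ω → K2ω
shrink (inj₁ _) = inj₁ 0
shrink (inj₂ _) = inj₂ 0

flip-shrink : K2ω → K2ω
flip-shrink x = swap (shrink x)

shrink-pres : ∀ x y → E x y → E (shrink x) (shrink y)
shrink-pres (inj₁ _) (inj₂ _) _ = tt
shrink-pres (inj₂ _) (inj₁ _) _ = tt

flip-shrink-pres : ∀ x y → E x y → E (flip-shrink x) (flip-shrink y)
flip-shrink-pres (inj₁ _) (inj₂ _) _ = tt
flip-shrink-pres (inj₂ _) (inj₁ _) _ = tt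

flip-shrink-edge : ∀ x y → E x y → flip-shrink x ≡ shrink y
flip-shrink-edge (inj₁ _) (inj₂ _) _ = refl
flip-shrink-edge (inj₂ _) (inj₁ _) _ = refl

flip : G → G
flip (i , x) = i , swap x

flip-edge : ∀ z → E₂ (flip z) z
flip-edge (i , inj₁ _) = refl , tt
flip-edge (i , inj₂ _) = refl , tt

product : (τ : ℕ → ℕ) → (∀ {i j} → τ i ≡ τ j → i ≡ j) →
          (f : K2ω → K2ω) → (∀ x y → E x y → E (f x) (f y)) → End
product τ τ-inj f f-pres = mkEnd (λ (i , x) → τ i , f x)
  (λ _ _ i≢j τi≡τj → i≢j (τ-inj τi≡τj))
  (λ _ _ (i≡j , xy) → cong τ i≡j , f-pres _ _ xy)

e ε : End
e = product id id shrink shrink-pres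
ε = product id id flip-shrink flip-shrink-pres

ε-edge : ∀ a b → E₂ a b → fun ε a ≡ fun e b
ε-edge (i , x) (.i , y) (refl , xy) = cong (i ,_) (flip-shrink-edge x y xy)

flips : ℕ → G → G
flips zero    z = z
flips (suc n) z = flips n (flip z)

-- Endomorphisms preserve the edge between `flip z` and `z`, and `ε` agrees with `e` across an edge;
-- hence one flip of the input offsets one occurrence of the variable.
evalPoly-ε : ∀ {k} (ps : Vec End (suc k)) z →
             fun (evalPoly ps ε) (flips k z) ≡ fun (evalPoly ps e) z
evalPoly-ε (p ∷ []) z = refl
evalPoly-ε (p ∷ q ∷ ps) z = cong (fun p) (trans
  (cong (fun ε) (evalPoly-ε (q ∷ ps) (flip z)))
  (ε-edge _ _ (pres₂ (evalPoly (q ∷ ps) e) _ _ (flip-edge z))))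

-- Equal lengths need equally many flips, so one shifted point serves both words.
M-ε : ∀ d → M d e → k d ≡ ℓ d → M d ε
M-ε (zdata n .n _ ps qs) (z , φ≢ψ) refl = flips n z , λ φ≡ψ →
  φ≢ψ (trans (sym (evalPoly-ε ps z)) (trans φ≡ψ (evalPoly-ε qs z)))

-- Fast-growing injections that encode word length

-- Pigeonhole: among b + i with i ≤ length P * b, each injective map comp p excludes at most b values.
abstract
  escape : (P : List End) (b : ℕ) → ∃[ v ] (b ≤ v × All (λ p → b ≤ comp p v) P)
  escape P b with Fin.any? (λ (i : Fin (suc (length P * b))) →
                              All.all? (λ p → b ≤? comp p (b + toℕ i)) P)
  ... | yes (i , all≥b) = b + toℕ i , m≤m+n b (toℕ i) , all≥b
  ... | no ¬good = let i , i′ , i<i′ , eq = Fin.pigeonhole (n<1+n _) code in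
    contradiction (code-injective eq) (<⇒≢ i<i′)
    where
    small : (i : Fin (suc (length P * b))) → ∃[ j ] comp (List.lookup P j) (b + toℕ i) < b
    small i with Fin.any? (λ j → comp (List.lookup P j) (b + toℕ i) <? b)
    ... | yes found = found
    ... | no  none  = contradiction
      (i , All.tabulate λ p∈P → subst (λ p → b ≤ comp p (b + toℕ i)) (sym (Any.lookup-index p∈P))
                                  (≮⇒≥ (λ lt → none (Any.index p∈P , lt)))) ¬good

    code : Fin (suc (length P * b)) → Fin (length P * b)
    code i = combine (proj₁ (small i)) (fromℕ< (proj₂ (small i)))

    code-injective : ∀ {i i′} → code i ≡ code i′ → toℕ i ≡ toℕ i′
    code-injective {i} {i′} eq =
      let j , lt = small i ; j′ , lt′ = small i′
          j≡j′ , value≡ = Fin.combine-injective j (fromℕ< lt) j′ (fromℕ< lt′) eq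
      in +-cancelˡ-≡ b _ _ (comp-injective (List.lookup P j)
           (trans (Fin.fromℕ<-injective _ _ lt lt′ value≡)
                  (cong (λ h → comp (List.lookup P h) (b + toℕ i′)) (sym j≡j′))))

letters : ZData → List End
letters d = toList (ps d) ++ toList (qs d)

module FastGrowth (P : List End) (B : ℕ) where

  values : ℕ → List ℕ
  values n = List.map (λ p → comp p n) P

  bound v : ℕ → ℕ
  -- Starting above `B` keeps the values of `v` off the fixed components, so that `τ` is injective.
  bound zero    = suc B
  bound (suc m) = suc (max (v m) (values (v m)))
  v m = proj₁ (escape P (bound m))

  -- The level of p (v m) is m, so a letter applied after τ can be peeled off a word.
  Level : ℕ → ℕ → Set
  Level m z = bound m ≤ z × z < bound (suc m)

  Spread : End → Set
  Spread p = ∀ m → Level m (comp p (v m))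

  v-level : ∀ m → Level m (v m)
  v-level m = proj₁ (proj₂ (escape P (bound m))) , s≤s (⊥≤max (v m) (values (v m)))

  P-spread : All Spread P
  P-spread = All.tabulate λ p∈P m →
    All.lookup (proj₂ (proj₂ (escape P (bound m)))) p∈P ,
    s≤s (All.lookup (xs≤max (v m) (values (v m))) (∈-map⁺ (λ p → comp p (v m)) p∈P))

  bound-step : ∀ m → bound m ≤ bound (suc m)
  bound-step m = ≤-trans (proj₁ (v-level m)) (<⇒≤ (proj₂ (v-level m)))

  bound-mono : ∀ {m n} → m ≤′ n → bound m ≤ bound n
  bound-mono ≤′-refl       = ≤-refl
  bound-mono (≤′-step m≤n) = ≤-trans (bound-mono m≤n) (bound-step _)

  level-≮ : ∀ m n {z} → Level m z → Level n z → ¬ m < n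
  level-≮ m n (_ , z<) (≤z , _) m<n =
    n≮n _ (<-≤-trans z< (≤-trans (bound-mono (≤⇒≤′ m<n)) ≤z))

  level-unique : ∀ m n {z} → Level m z → Level n z → m ≡ n
  level-unique m n lm ln = ≤-antisym (≮⇒≥ (level-≮ n m ln lm)) (≮⇒≥ (level-≮ m n lm ln))

  level-≥ : ∀ m {z} → Level m z → bound 0 ≤ z
  level-≥ m (≤z , _) = ≤-trans (bound-mono (≤⇒≤′ z≤n)) ≤z

  τ : ℕ → ℕ
  τ i with i ≤? B
  ... | yes _ = i
  ... | no  _ = v i

  τ-fix : ∀ {i} → i ≤ B → τ i ≡ i
  τ-fix {i} i≤B with i ≤? B
  ... | yes _   = refl
  ... | no  i≰B = contradiction i≤B i≰B

  τ-grow : ∀ {i} → bound 0 ≤ i → τ i ≡ v i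
  τ-grow {i} B<i with i ≤? B
  ... | yes i≤B = contradiction i≤B (<⇒≱ B<i)
  ... | no  _   = refl

  τ-injective : ∀ {i j} → τ i ≡ τ j → i ≡ j
  τ-injective {i} {j} eq with i ≤? B | j ≤? B
  ... | yes _   | yes _   = eq
  ... | yes i≤B | no  _   = contradiction (subst (_≤ B) eq i≤B) (<⇒≱ (level-≥ j (v-level j)))
  ... | no  _   | yes j≤B = contradiction (subst (_≤ B) (sym eq) j≤B) (<⇒≱ (level-≥ i (v-level i)))
  ... | no  _   | no  _   = level-unique i j (v-level i) (subst (Level j) (sym eq) (v-level j))

  t : End
  t = product τ τ-injective flip-shrink flip-shrink-pres

  -- Starting from `v 0` gives even a one-letter word a level, namely 0.
  endpoint : ∀ {k} → Vec End (suc k) → ℕ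
  endpoint ps = comp (evalPoly ps t) (v 0)

  -- Proved together with `endpoint-level`: peeling a letter requires the shorter word to end beyond
  -- `B`, where `τ` is `v`, and having a level ensures this.
  endpoint-≥ : ∀ {k} (ps : Vec End (suc k)) → All Spread (toList ps) → bound 0 ≤ endpoint ps
  endpoint-level : ∀ {k} p (ps : Vec End (suc k)) → All Spread (toList (p ∷ ps)) →
                   Level (endpoint ps) (endpoint (p ∷ ps))

  endpoint-≥ (p ∷ [])     (sp ∷ _) = level-≥ 0 (sp 0)
  endpoint-≥ (p ∷ q ∷ ps) sps      = level-≥ (endpoint (q ∷ ps)) (endpoint-level p (q ∷ ps) sps)

  endpoint-level p (q ∷ ps) (sp ∷ sps) = subst (Level u) (sym eq) (sp u)
    where
    u = endpoint (q ∷ ps)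
    eq : endpoint (p ∷ q ∷ ps) ≡ comp p (v u)
    eq = trans (comp-fun p _) (cong (comp p) (τ-grow (endpoint-≥ (q ∷ ps) sps)))

  -- The levels differ: 0 for the single letter, and an endpoint above `B` for the longer word.
  endpoint-short≢long : ∀ {l} p (q : End) (qs : Vec End (suc l)) →
                        All Spread (toList (p ∷ [])) → All Spread (toList (q ∷ qs)) →
                        endpoint (p ∷ []) ≢ endpoint (q ∷ qs)
  endpoint-short≢long p q qs (sp ∷ _) (sq ∷ sqs) eq =
    <⇒≢ (<-≤-trans z<s (endpoint-≥ qs sqs))
        (level-unique 0 (endpoint qs) (subst (Level 0) eq (sp 0)) (endpoint-level q qs (sq ∷ sqs)))

  -- Equal endpoints have equal levels, and these are the endpoints of the words without their
  -- leading letters. The induction never compares the letters themselves.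
  endpoint-length : ∀ {k l} (ps : Vec End (suc k)) (qs : Vec End (suc l)) →
                    All Spread (toList ps) → All Spread (toList qs) →
                    endpoint ps ≡ endpoint qs → k ≡ l
  endpoint-length (p ∷ []) (q ∷ []) _ _ _ = refl
  endpoint-length (p ∷ []) (q ∷ q′ ∷ qs) sps sqs eq =
    contradiction eq (endpoint-short≢long p q (q′ ∷ qs) sps sqs)
  endpoint-length (p ∷ p′ ∷ ps) (q ∷ []) sps sqs eq =
    contradiction (sym eq) (endpoint-short≢long q p (p′ ∷ ps) sqs sps)
  endpoint-length (p ∷ p′ ∷ ps) (q ∷ q′ ∷ qs) (sp ∷ sps) (sq ∷ sqs) eq =
    cong suc (endpoint-length (p′ ∷ ps) (q′ ∷ qs) sps sqs
      (level-unique (endpoint (p′ ∷ ps)) (endpoint (q′ ∷ qs)) (endpoint-level p (p′ ∷ ps) (sp ∷ sps))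
        (subst (Level (endpoint (q′ ∷ qs))) (sym eq) (endpoint-level q (q′ ∷ qs) (sq ∷ sqs)))))

  M-t : ∀ d → All Spread (letters d) → (k d ≡ ℓ d → M d t) → M d t
  M-t d spread k≡ℓ⇒M with k d ≟ ℓ d
  ... | yes k≡ℓ = k≡ℓ⇒M k≡ℓ
  ... | no  k≢ℓ = (v 0 , inj₁ 0) , λ φ≡ψ →
    k≢ℓ (endpoint-length (ps d) (qs d)
          (All.++⁻ˡ _ spread) (All.++⁻ʳ (toList (ps d)) spread) (cong proj₁ φ≡ψ))

-- Strictness of the inclusion

flipped-solution : ∀ ds → All (λ d → M d e) ds →
  ∃[ t ] (All (λ d → M d t) ds × fun t (0 , inj₁ 0) ≢ (0 , inj₁ 0))
flipped-solution ds e∈M = t , All.zipWith (λ {d} (k≡ℓ⇒M , spread) → M-t d spread k≡ℓ⇒M)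
    (proj₂ near-ε t agree , All.map⁻ (All.concat⁻ P-spread)) , λ ()
  where
  -- Only inequations between words of equal length are demanded near `ε`; the others may fail at
  -- `ε` itself.
  near-ε = All-open (λ d → →-open (k d ≟ ℓ d) (M-open d)) ds ε (All.map (λ {d} → M-ε d) e∈M)
  F = proj₁ near-ε

  -- `B` is the largest component meeting `F`, so `τ` fixes all of these and `t` agrees with `ε` on
  -- `F`; the 0 covers empty `F`.
  open FastGrowth (concatMap letters ds) (max 0 (List.map proj₁ F))

  agree : Agree F t ε
  agree (i , x) z∈F =
    cong (_, flip-shrink x) (τ-fix (All.lookup (xs≤max 0 _) (∈-map⁺ proj₁ z∈F)))

theorem4p9 : ((U : Subset) → ZariskiOpen U → PointwiseOpen U)
    × Σ Subset (λ U → PointwiseOpen U × ¬ ZariskiOpen U)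
theorem4p9 = zariski⇒pointwise , U , U-open , U-not-zariski
  where
  a : G
  a = 0 , inj₁ 0

  U : Subset
  U t = fun t a ≡ a

  U-open : PointwiseOpen U
  U-open s sa≡a = [ a ] , λ t ag → trans (ag a (here refl)) sa≡a

  U-not-zariski : ¬ ZariskiOpen U
  U-not-zariski zariski =
    let ds , e∈M , M⊆U = zariski e refl
        t , t∈M , ta≢a = flipped-solution ds e∈M
    in ta≢a (M⊆U t t∈M)
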